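{- Let $A$ be a commutative unitary ring (with $0_A\neq1_A$). Then $\ell_{A[[X]]}=+\infty$, where $A[[X]]$ is the ring of formal power series over $A$.
   Context: All rings are commutative, unitary and nonzero. For a ring $B$ and $a_1,\dots,a_n\in B$, set $M_n(a_1,\dots,a_n)=\begin{pmatrix}a_n&-1\\1&0\end{pmatrix}\cdots\begin{pmatrix}a_1&-1\\1&0\end{pmatrix}$. An $n$-tuple $(a_1,\dots,a_n)\in B^n$ is a $\lambda$-quiddity over $B$ if $M_n(a_1,\dots,a_n)=\epsilon\,\mathrm{Id}$ for some $\epsilon\in\{\pm1_B\}$. For $(a_1,\dots,a_n)\in B^n$, $(b_1,\dots,b_m)\in B^m$ define $(a_1,\dots,a_n)\oplus(b_1,\dots,b_m)=(a_1+b_m,a_2,\dots,a_{n-1},a_n+b_1,b_2,\dots,b_{m-1})$. Two $n$-tuples are equivalent ($\sim$) if one is obtained from the other or from its reversal by a cyclic rotation. A $\lambda$-quiddity $(c_1,\dots,c_n)$ with $n\ge3$ is reducible if there exist a $\lambda$-quiddity $(b_1,\dots,b_l)$ and $(a_1,\dots,a_m)\in B^m$ with $m,l\ge3$ and $(c_1,\dots,c_n)\sim(a_1,\dots,a_m)\oplus(b_1,\dots,b_l)$; otherwise it is irreducible ($(0,0)$ is never irreducible). $\ell_B$ is the maximal size of irreducible $\lambda$-quiddities over $B$ if bounded, and $+\infty$ otherwise. -}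

module Defs where

open import Level using (Level; _⊔_)
open import Data.Nat using (ℕ; zero; suc; _∸_; _≤_)
open import Data.List using (List; []; _∷_; _++_; [_]; length; reverse)
open import Data.List.Relation.Binary.Pointwise using (Pointwise)
open import Data.Product using (Σ; ∃; _×_; _,_)
open import Data.Sum using (_⊎_)
open import Relation.Nullary using (¬_)
open import Algebra.Bundles using (CommutativeRing)
open import Algebra.Bundles.Raw using (RawRing)

module Quiddity {c ℓ : Level} (B : RawRing c ℓ) where
  open RawRing B

  record Mat : Set c where
    constructor mat
    field
      m11 m12 m21 m22 : Carrier

  _·_ : Mat → Mat → Mat
  mat a b c' d · mat e f g h =
    mat (a * e + b * g) (a * f + b * h) (c' * e + d * g) (c' * f + d * h)

  Id : Mat
  Id = mat 1# 0# 0# 1#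

  E : Carrier → Mat
  E a = mat a (- 1#) 1# 0#

  -- M_n(a_1,...,a_n) = E(a_n) ⋯ E(a_1)  =  M_{n-1}(a_2,...,a_n) · E(a_1)
  M : List Carrier → Mat
  M []       = Id
  M (a ∷ as) = M as · E a

  IsScalar : Carrier → Mat → Set ℓ
  IsScalar e (mat a b c' d) = (a ≈ e) × (b ≈ 0#) × (c' ≈ 0#) × (d ≈ e)

  LambdaQuiddity : List Carrier → Set ℓ
  LambdaQuiddity as = IsScalar 1# (M as) ⊎ IsScalar (- 1#) (M as)

  last′ : Carrier → List Carrier → Carrier
  last′ x []       = x
  last′ _ (y ∷ ys) = last′ y ys

  init′ : List Carrier → List Carrier
  init′ []       = []
  init′ (x ∷ []) = []
  init′ (x ∷ y ∷ ys) = x ∷ init′ (y ∷ ys)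

  -- (a_1,...,a_n) ⊕ (b_1,...,b_m)
  --   = (a_1 + b_m, a_2, ..., a_{n-1}, a_n + b_1, b_2, ..., b_{m-1})
  -- (only used for n, m ≥ 3; degenerate inputs give [])
  _⊕_ : List Carrier → List Carrier → List Carrier
  []       ⊕ _        = []
  (_ ∷ _)  ⊕ []       = []
  (a₁ ∷ as) ⊕ (b₁ ∷ bs) =
    (a₁ + last′ b₁ bs) ∷ (init′ as ++ ((last′ a₁ as + b₁) ∷ init′ bs))

  rot : List Carrier → List Carrier
  rot []       = []
  rot (x ∷ xs) = xs ++ [ x ]

  rotN : ℕ → List Carrier → List Carrier
  rotN zero    xs = xs
  rotN (suc k) xs = rot (rotN k xs)

  _≋_ : List Carrier → List Carrier → Set (c ⊔ ℓ)
  _≋_ = Pointwise _≈_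

  _∼_ : List Carrier → List Carrier → Set (c ⊔ ℓ)
  cs ∼ ds = ∃ λ k → (cs ≋ rotN k ds) ⊎ (cs ≋ rotN k (reverse ds))

  Reducible : List Carrier → Set (c ⊔ ℓ)
  Reducible cs =
    Σ (List Carrier) λ as → Σ (List Carrier) λ bs →
      (3 ≤ length as) × (3 ≤ length bs) × LambdaQuiddity bs × (cs ∼ (as ⊕ bs))

  Irreducible : List Carrier → Set (c ⊔ ℓ)
  Irreducible cs = (3 ≤ length cs) × LambdaQuiddity cs × ¬ Reducible cs

  EllInfinite : Set (c ⊔ ℓ)
  EllInfinite = (N : ℕ) → Σ (List Carrier) λ cs → (N ≤ length cs) × Irreducible cs

module PowerSeries {c ℓ : Level} (A : CommutativeRing c ℓ) where
  open CommutativeRing A using (Carrier; _≈_; _+_; _*_; -_; 0#; 1#)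

  sumTo : (ℕ → Carrier) → ℕ → Carrier
  sumTo h zero    = h zero
  sumTo h (suc n) = sumTo h n + h (suc n)

  PowerSeriesRing : RawRing c ℓ
  PowerSeriesRing = record
    { Carrier = ℕ → Carrier
    ; _≈_     = λ f g → (n : ℕ) → f n ≈ g n
    ; _+_     = λ f g n → f n + g n
    ; _*_     = λ f g n → sumTo (λ i → f i * g (n ∸ i)) n
    ; -_      = λ f n → - f n
    ; 0#      = λ _ → 0#
    ; 1#      = λ { zero → 1# ; (suc _) → 0# }
    }

{-# OPTIONS --safe #-}
module Submission where

-- Write K for the (1,1) entry of M. A reducible quiddity has a proper cyclic block with
-- K = ±1, and by complementarity even one avoiding the two ends of the list. On the other
-- hand any d with K(d) = −1 extends to a quiddity (x, d, z).
-- Take d = (y, X, …, X) with n = 4N entries X: the constant term of K(Xⁿ) is 1, so K(Xⁿ) is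
-- invertible and y can be chosen to make K(d) = −1. Since K(Xʲ) is monic of degree j in X,
-- Euler's continuant identity shows that no proper block of d has K = ±1.

open import Defs
open import Level using (Level; _⊔_)
open import Relation.Nullary using (¬_)
open import Algebra.Bundles using (CommutativeRing; RawRing)
import Algebra.Properties.AbelianGroup
import Algebra.Properties.CommutativeSemigroup
import Algebra.Properties.Monoid.Mult.TCOptimised
import Algebra.Properties.Ring
import Algebra.Properties.Semiring.Mult.TCOptimised
import Algebra.Solver.Ring
open import Algebra.Solver.Ring.AlmostCommutativeRing
  using (_-Raw-AlmostCommutative⟶_; fromCommutativeRing)
open import Data.Integer.Base as ℤ using (ℤ; +_; -[1+_]; _⊖_; _◃_)
import Data.Integer.Properties as ℤ
open import Data.List.Base
  using (List; []; _∷_; _++_; [_]; length; reverse; replicate; initLast; _∷ʳ′_)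
import Data.List.Properties as List
open import Data.List.Relation.Binary.Pointwise as Pointwise using (Pointwise; []; _∷_)
open import Data.Maybe.Base using (map)
open import Data.Nat.Base as ℕ using (ℕ; zero; suc; _∸_; _≤_; _<_; z≤n; s≤s)
import Data.Nat.Properties as ℕ
open import Data.Product.Base using (∃; _×_; _,_; proj₁; proj₂)
open import Data.Sign.Base as Sign using (Sign)
open import Data.Sum.Base using (_⊎_; inj₁; inj₂)
open import Function.Base using (_∘_)
open import Relation.Binary.Consequences using (dec⇒weaklyDec)
open import Relation.Binary.PropositionalEquality as ≡ using (_≡_)
import Relation.Binary.Reasoning.Setoid as SetoidReasoning

-- A ring solver with integer coefficients over any commutative ring.

module IntegerSolver {c ℓ : Level} (R : CommutativeRing c ℓ) where
  open CommutativeRing R hiding (zero)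
  open Algebra.Properties.AbelianGroup +-abelianGroup
    using (ε⁻¹≈ε; ⁻¹-∙-comm; ⁻¹-involutive)
  open Algebra.Properties.Monoid.Mult.TCOptimised +-monoid using (1+×; ×-homo-+)
    renaming (_×_ to _×ᴿ_)
  open Algebra.Properties.Ring ring using (-‿distribˡ-*; -‿distribʳ-*)
  open Algebra.Properties.Semiring.Mult.TCOptimised semiring using (×1-homo-*)
  open SetoidReasoning setoid

  private
    -- With the optimised multiple, `1 ×ᴿ 1#` is `1#` by computation, so `:0` and `:1` evaluate to
    -- the literal `0#` and `1#` occurring in `Id` and `E`.
    fromℤ : ℤ → Carrier
    fromℤ (+ n)    = n ×ᴿ 1#
    fromℤ -[1+ n ] = - (suc n ×ᴿ 1#)

    fromSign : Sign → Carrier → Carrier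
    fromSign Sign.+ x = x
    fromSign Sign.- x = - x

    fromℤ-⊖ : ∀ m n → fromℤ (m ⊖ n) ≈ m ×ᴿ 1# - n ×ᴿ 1#
    fromℤ-⊖ m       zero    = sym (trans (+-congˡ ε⁻¹≈ε) (+-identityʳ _))
    fromℤ-⊖ zero    (suc n) = sym (+-identityˡ _)
    fromℤ-⊖ (suc m) (suc n) = begin
      fromℤ (suc m ⊖ suc n)                    ≡⟨ ≡.cong fromℤ (ℤ.[1+m]⊖[1+n]≡m⊖n m n) ⟩
      fromℤ (m ⊖ n)                            ≈⟨ fromℤ-⊖ m n ⟩
      m ×ᴿ 1# - n ×ᴿ 1#                          ≈⟨ +-congʳ (+-identityʳ _) ⟨
      (m ×ᴿ 1# + 0#) - n ×ᴿ 1#                   ≈⟨ +-congʳ (+-congˡ (-‿inverseʳ 1#)) ⟨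
      (m ×ᴿ 1# + (1# - 1#)) - n ×ᴿ 1#            ≈⟨ +-congʳ (+-assoc _ _ _) ⟨
      ((m ×ᴿ 1# + 1#) - 1#) - n ×ᴿ 1#            ≈⟨ +-assoc _ _ _ ⟩
      (m ×ᴿ 1# + 1#) + (- 1# - n ×ᴿ 1#)          ≈⟨ +-cong (+-comm _ _) (⁻¹-∙-comm _ _) ⟩
      (1# + m ×ᴿ 1#) - (1# + n ×ᴿ 1#)            ≈⟨ +-cong (1+× m 1#) (-‿cong (1+× n 1#)) ⟨
      suc m ×ᴿ 1# - suc n ×ᴿ 1#                  ∎

    fromℤ-◃ : ∀ s n → fromℤ (s ◃ n) ≈ fromSign s (n ×ᴿ 1#)
    fromℤ-◃ Sign.+ zero    = refl
    fromℤ-◃ Sign.- zero    = sym ε⁻¹≈ε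
    fromℤ-◃ Sign.+ (suc n) = refl
    fromℤ-◃ Sign.- (suc n) = refl

    fromℤ-+ : ∀ i j → fromℤ (i ℤ.+ j) ≈ fromℤ i + fromℤ j
    fromℤ-+ (+ m)    (+ n)    = ×-homo-+ 1# m n
    fromℤ-+ (+ m)    -[1+ n ] = fromℤ-⊖ m (suc n)
    fromℤ-+ -[1+ m ] (+ n)    = trans (fromℤ-⊖ n (suc m)) (+-comm _ _)
    fromℤ-+ -[1+ m ] -[1+ n ] = begin
      - (suc (suc (m ℕ.+ n)) ×ᴿ 1#)  ≡⟨ ≡.cong (λ k → - (suc k ×ᴿ 1#)) (ℕ.+-suc m n) ⟨
      - ((suc m ℕ.+ suc n) ×ᴿ 1#)    ≈⟨ -‿cong (×-homo-+ 1# (suc m) (suc n)) ⟩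
      - (suc m ×ᴿ 1# + suc n ×ᴿ 1#)               ≈⟨ ⁻¹-∙-comm _ _ ⟨
      - (suc m ×ᴿ 1#) - suc n ×ᴿ 1#               ∎

    fromℤ-* : ∀ i j → fromℤ (i ℤ.* j) ≈ fromℤ i * fromℤ j
    fromℤ-* (+ m)    (+ n)    = trans (fromℤ-◃ Sign.+ (m ℕ.* n)) (×1-homo-* m n)
    fromℤ-* (+ m)    -[1+ n ] = trans (fromℤ-◃ Sign.- (m ℕ.* suc n))
      (trans (-‿cong (×1-homo-* m (suc n))) (-‿distribʳ-* _ _))
    fromℤ-* -[1+ m ] (+ n)    = trans (fromℤ-◃ Sign.- (suc m ℕ.* n))
      (trans (-‿cong (×1-homo-* (suc m) n)) (-‿distribˡ-* _ _))
    fromℤ-* -[1+ m ] -[1+ n ] = begin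
      (suc m ℕ.* suc n) ×ᴿ 1#     ≈⟨ ×1-homo-* (suc m) (suc n) ⟩
      suc m ×ᴿ 1# * (suc n ×ᴿ 1#)              ≈⟨ ⁻¹-involutive _ ⟨
      - (- (suc m ×ᴿ 1# * (suc n ×ᴿ 1#)))      ≈⟨ -‿cong (-‿distribˡ-* _ _) ⟩
      - (- (suc m ×ᴿ 1#) * (suc n ×ᴿ 1#))      ≈⟨ -‿distribʳ-* _ _ ⟩
      - (suc m ×ᴿ 1#) * - (suc n ×ᴿ 1#)        ∎

    fromℤ-neg : ∀ i → fromℤ (ℤ.- i) ≈ - fromℤ i
    fromℤ-neg (+ zero)  = sym ε⁻¹≈ε
    fromℤ-neg (+ suc n) = refl
    fromℤ-neg -[1+ n ]  = sym (⁻¹-involutive _)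

    morphism : ℤ.+-*-rawRing -Raw-AlmostCommutative⟶ fromCommutativeRing R
    morphism = record
      { ⟦_⟧    = fromℤ
      ; +-homo = fromℤ-+
      ; *-homo = fromℤ-*
      ; -‿homo = fromℤ-neg
      ; 0-homo = refl
      ; 1-homo = refl
      }

  open Algebra.Solver.Ring ℤ.+-*-rawRing (fromCommutativeRing R) morphism
    (λ i j → map (λ i≡j → reflexive (≡.cong fromℤ i≡j)) (dec⇒weaklyDec ℤ._≟_ i j)) public
    using (Polynomial; con; solve; _:=_; _:+_; _:*_; :-_)

  :0 :1 : ∀ {n} → Polynomial n
  :0 = con (+ 0)
  :1 = con (+ 1)

-- The commutative ring of formal power series and some of its units.

module PowerSeriesTheory {c ℓ : Level} (A : CommutativeRing c ℓ) where
  open CommutativeRing A hiding (zero)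
  open Algebra.Properties.CommutativeSemigroup +-commutativeSemigroup
    using (interchange; x∙yz≈y∙xz)
  open SetoidReasoning setoid
  open PowerSeries A
  private module S = RawRing PowerSeriesRing

  sumTo-cong : ∀ {h k} → (∀ i → h i ≈ k i) → ∀ n → sumTo h n ≈ sumTo k n
  sumTo-cong h≈k zero    = h≈k zero
  sumTo-cong h≈k (suc n) = +-cong (sumTo-cong h≈k n) (h≈k (suc n))

  sumTo-+ : ∀ h k n → sumTo (λ i → h i + k i) n ≈ sumTo h n + sumTo k n
  sumTo-+ h k zero    = refl
  sumTo-+ h k (suc n) = trans (+-congʳ (sumTo-+ h k n)) (interchange _ _ _ _)

  sumTo-*ˡ : ∀ a h n → sumTo (λ i → a * h i) n ≈ a * sumTo h n
  sumTo-*ˡ a h zero    = refl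
  sumTo-*ˡ a h (suc n) = trans (+-congʳ (sumTo-*ˡ a h n)) (sym (distribˡ a _ _))

  sumTo-suc : ∀ h n → sumTo h (suc n) ≈ h 0 + sumTo (h ∘ suc) n
  sumTo-suc h zero    = refl
  sumTo-suc h (suc n) = trans (+-congʳ (sumTo-suc h n)) (+-assoc _ _ _)

  -- Splitting off the term i = 0 leaves a Cauchy product with the tail of `f` in lower degree; the
  -- ring laws below are inductions along this recursion.
  *-suc : ∀ f g n → (f S.* g) (suc n) ≈ f 0 * g (suc n) + ((f ∘ suc) S.* g) n
  *-suc f g n = sumTo-suc (λ i → f i * g (suc n ∸ i)) n

  S-*-cong : ∀ {f f′ g g′} → f S.≈ f′ → g S.≈ g′ → (f S.* g) S.≈ (f′ S.* g′)
  S-*-cong f≈f′ g≈g′ n = sumTo-cong (λ i → *-cong (f≈f′ i) (g≈g′ (n ∸ i))) n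

  S-distribʳ : ∀ h f g → ((f S.+ g) S.* h) S.≈ ((f S.* h) S.+ (g S.* h))
  S-distribʳ h f g n =
    trans (sumTo-cong (λ i → distribʳ (h (n ∸ i)) (f i) (g i)) n) (sumTo-+ _ _ n)

  scale-* : ∀ a f g → ((λ n → a * f n) S.* g) S.≈ (λ n → a * (f S.* g) n)
  scale-* a f g n = trans (sumTo-cong (λ i → *-assoc a (f i) (g (n ∸ i))) n) (sumTo-*ˡ a _ n)

  -- Peeling the constant term off one factor and then off the other lowers the degree by two, hence
  -- the separate case of degree one.
  S-*-comm : ∀ f g → (f S.* g) S.≈ (g S.* f)
  S-*-comm f g zero = *-comm (f 0) (g 0)
  S-*-comm f g (suc zero) = begin
    f 0 * g 1 + f 1 * g 0  ≈⟨ +-comm _ _ ⟩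
    f 1 * g 0 + f 0 * g 1  ≈⟨ +-cong (*-comm _ _) (*-comm _ _) ⟩
    g 0 * f 1 + g 1 * f 0  ∎
  S-*-comm f g (suc (suc n)) = begin
    (f S.* g) (suc (suc n))                                ≈⟨ *-suc f g (suc n) ⟩
    a + (f′ S.* g) (suc n)                                 ≈⟨ +-congˡ (S-*-comm f′ g (suc n)) ⟩
    a + (g S.* f′) (suc n)                                 ≈⟨ +-congˡ (*-suc g f′ n) ⟩
    a + (b + (g′ S.* f′) n)                                ≈⟨ x∙yz≈y∙xz _ _ _ ⟩
    b + (a + (g′ S.* f′) n)                                ≈⟨ +-congˡ (+-congˡ (S-*-comm g′ f′ n)) ⟩
    b + (a + (f′ S.* g′) n)                                ≈⟨ +-congˡ (*-suc f g′ n) ⟨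
    b + (f S.* g′) (suc n)                                 ≈⟨ +-congˡ (S-*-comm f g′ (suc n)) ⟩
    b + (g′ S.* f) (suc n)                                 ≈⟨ *-suc g f (suc n) ⟨
    (g S.* f) (suc (suc n))                                ∎
    where
    f′ = f ∘ suc
    g′ = g ∘ suc
    a  = f 0 * g (suc (suc n))
    b  = g 0 * f (suc (suc n))

  -- Induction on the degree, for all `f` at once: the tail of the product of `f` and `g` is `f 0`
  -- times the tail of `g`, plus the tail of `f` times `g`.
  S-*-assoc : ∀ f g h → ((f S.* g) S.* h) S.≈ (f S.* (g S.* h))
  S-*-assoc f g h zero    = *-assoc _ _ _
  S-*-assoc f g h (suc n) = begin
    ((f S.* g) S.* h) (suc n)
      ≈⟨ *-suc (f S.* g) h n ⟩
    f 0 * g 0 * h (suc n) + (((f S.* g) ∘ suc) S.* h) n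
      ≈⟨ +-congˡ (S-*-cong {g = h} (*-suc f g) (λ _ → refl) n) ⟩
    f 0 * g 0 * h (suc n) + (((λ m → f 0 * g (suc m)) S.+ (f′ S.* g)) S.* h) n
      ≈⟨ +-congˡ (S-distribʳ h _ _ n) ⟩
    f 0 * g 0 * h (suc n) + (((λ m → f 0 * g (suc m)) S.* h) n + ((f′ S.* g) S.* h) n)
      ≈⟨ +-cong (*-assoc _ _ _) (+-cong (scale-* (f 0) (g ∘ suc) h n) (S-*-assoc f′ g h n)) ⟩
    f 0 * (g 0 * h (suc n)) + (f 0 * ((g ∘ suc) S.* h) n + (f′ S.* (g S.* h)) n)
      ≈⟨ +-assoc _ _ _ ⟨
    (f 0 * (g 0 * h (suc n)) + f 0 * ((g ∘ suc) S.* h) n) + (f′ S.* (g S.* h)) n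
      ≈⟨ +-congʳ (distribˡ _ _ _) ⟨
    f 0 * (g 0 * h (suc n) + ((g ∘ suc) S.* h) n) + (f′ S.* (g S.* h)) n
      ≈⟨ +-congʳ (*-congˡ (*-suc g h n)) ⟨
    f 0 * (g S.* h) (suc n) + (f′ S.* (g S.* h)) n
      ≈⟨ *-suc f (g S.* h) n ⟨
    (f S.* (g S.* h)) (suc n) ∎
    where f′ = f ∘ suc

  0-* : ∀ g → (S.0# S.* g) S.≈ S.0#
  0-* g zero    = zeroˡ _
  0-* g (suc n) = trans (*-suc S.0# g n) (trans (+-cong (zeroˡ _) (0-* g n)) (+-identityʳ 0#))

  S-*-identityˡ : ∀ g → (S.1# S.* g) S.≈ g
  S-*-identityˡ g zero    = *-identityˡ _
  S-*-identityˡ g (suc n) =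
    trans (*-suc S.1# g n) (trans (+-cong (*-identityˡ _) (0-* g n)) (+-identityʳ _))

  powerSeries : CommutativeRing c ℓ
  powerSeries = record
    { Carrier = S.Carrier ; _≈_ = S._≈_ ; _+_ = S._+_ ; _*_ = S._*_
    ; -_ = S.-_ ; 0# = S.0# ; 1# = S.1#
    ; isCommutativeRing = record
      { isRing = record
        { +-isAbelianGroup = record
          { isGroup = record
            { isMonoid = record
              { isSemigroup = record
                { isMagma = record
                  { isEquivalence = record
                    { refl  = λ _ → refl
                    ; sym   = λ p n → sym (p n)
                    ; trans = λ p q n → trans (p n) (q n)
                    }
                  ; ∙-cong = λ p q n → +-cong (p n) (q n)
                  }
                ; assoc = λ f g h n → +-assoc (f n) (g n) (h n)
                }
              ; identity = (λ f n → +-identityˡ (f n)) , (λ f n → +-identityʳ (f n))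
              }
            ; inverse = (λ f n → -‿inverseˡ (f n)) , (λ f n → -‿inverseʳ (f n))
            ; ⁻¹-cong = λ p n → -‿cong (p n)
            }
          ; comm = λ f g n → +-comm (f n) (g n)
          }
        ; *-cong     = S-*-cong
        ; *-assoc    = S-*-assoc
        ; *-identity = S-*-identityˡ , λ g n → trans (S-*-comm g S.1# n) (S-*-identityˡ g n)
        ; distrib    =
            (λ h f g n → trans (S-*-comm h (f S.+ g) n)
              (trans (S-distribʳ h f g n) (+-cong (S-*-comm f h n) (S-*-comm g h n))))
          , S-distribʳ
        }
      ; *-comm = S-*-comm
      }
    }

  X : S.Carrier
  X zero    = 0#
  X (suc n) = S.1# n

  X-*-suc : ∀ f n → (X S.* f) (suc n) ≈ f n
  X-*-suc f n = trans (*-suc X f n)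
    (trans (+-cong (zeroˡ _) (S-*-identityˡ f n)) (+-identityˡ _))

  -- The inverse g of f satisfies g(n+1) = − (tail f · g)(n); the k-th approximant
  -- is correct in degrees ≤ k.
  private
    approx : S.Carrier → ℕ → S.Carrier
    approx f k       zero    = 1#
    approx f zero    (suc n) = 0#
    approx f (suc k) (suc n) = - ((f ∘ suc) S.* approx f k) n

    approx-stable : ∀ f {k l n} → n ≤ k → n ≤ l → approx f k n ≈ approx f l n
    approx-stable f z≤n       z≤n       = refl
    approx-stable f {n = suc n} (s≤s n≤k) (s≤s n≤l) = -‿cong (sumTo-cong (λ i → *-congˡ
      (approx-stable f (ℕ.≤-trans (ℕ.m∸n≤m n i) n≤k) (ℕ.≤-trans (ℕ.m∸n≤m n i) n≤l))) n)

  invertible : ∀ f → f 0 ≈ 1# → ∃ λ g → (f S.* g) S.≈ S.1#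
  invertible f f0≈1 = g , f*g≈1
    where
    g : S.Carrier
    g n = approx f n n

    f*g≈1 : (f S.* g) S.≈ S.1#
    f*g≈1 zero    = trans (*-identityʳ _) f0≈1
    f*g≈1 (suc n) = begin
      (f S.* g) (suc n)
        ≈⟨ *-suc f g n ⟩
      f 0 * g (suc n) + ((f ∘ suc) S.* g) n
        ≈⟨ +-congʳ (trans (*-congʳ f0≈1) (*-identityˡ _)) ⟩
      - ((f ∘ suc) S.* approx f n) n + ((f ∘ suc) S.* g) n
        -- Only degrees up to n occur here, and there the diagonal `g` agrees with the n-th
        -- approximant.
        ≈⟨ +-congˡ (sumTo-cong (λ i → *-congˡ (approx-stable f ℕ.≤-refl (ℕ.m∸n≤m n i))) n) ⟩
      - ((f ∘ suc) S.* approx f n) n + ((f ∘ suc) S.* approx f n) n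
        ≈⟨ -‿inverseˡ _ ⟩
      0# ∎

-- Lengths and decompositions of lists.

length-∷ʳ : ∀ {a} {A : Set a} (ps : List A) p → length (ps ++ [ p ]) ≡ suc (length ps)
length-∷ʳ ps p = ≡.trans (List.length-++ ps) (ℕ.+-comm _ 1)

length-++-∷ʳ : ∀ {a} {A : Set a} (ps qs : List A) p →
  length (ps ++ qs ++ [ p ]) ≡ suc (length (ps ++ qs))
length-++-∷ʳ ps qs p = ≡.trans (≡.cong length (≡.sym (List.++-assoc ps qs [ p ])))
  (length-∷ʳ (ps ++ qs) p)

++-assoc₃ : ∀ {a} {A : Set a} (ps us qs rs : List A) →
  ps ++ us ++ qs ++ rs ≡ (ps ++ us ++ qs) ++ rs
++-assoc₃ ps us qs rs = ≡.trans (≡.cong (ps ++_) (≡.sym (List.++-assoc us qs rs)))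
  (≡.sym (List.++-assoc ps (us ++ qs) rs))

∃-ends : ∀ {a} {A : Set a} {n} (xs : List A) → suc (suc n) ≤ length xs →
  ∃ λ u → ∃ λ vs → ∃ λ v → xs ≡ u ∷ vs ++ [ v ] × n ≤ length vs
∃-ends (u ∷ xs) (s≤s n<) with initLast xs
∃-ends (u ∷ .(vs ++ [ v ])) (s≤s n<) | vs ∷ʳ′ v =
  u , vs , v , ≡.refl , ℕ.s≤s⁻¹ (≡.subst (_ ≤_) (length-∷ʳ vs v) n<)

-- Matrices `M` and continuants over a commutative ring.

module QuiddityTheory {c ℓ : Level} (R : CommutativeRing c ℓ) where
  open CommutativeRing R hiding (zero)
  open Algebra.Properties.Ring ring using (-‿involutive; -0#≈0#; -1*x≈-x)
  open Quiddity rawRing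
  open IntegerSolver R
  open Mat

  infix 4 _≈ᴹ_
  -- A record rather than a product of equations, so that both matrices can be inferred from a
  -- proof.
  record _≈ᴹ_ (P Q : Mat) : Set ℓ where
    constructor eqᴹ
    field
      eq11 : m11 P ≈ m11 Q
      eq12 : m12 P ≈ m12 Q
      eq21 : m21 P ≈ m21 Q
      eq22 : m22 P ≈ m22 Q
  open _≈ᴹ_

  ≈ᴹ-refl : ∀ {P} → P ≈ᴹ P
  ≈ᴹ-refl = eqᴹ refl refl refl refl

  ≈ᴹ-sym : ∀ {P Q} → P ≈ᴹ Q → Q ≈ᴹ P
  ≈ᴹ-sym (eqᴹ a b c d) = eqᴹ (sym a) (sym b) (sym c) (sym d)

  ≈ᴹ-trans : ∀ {P Q S} → P ≈ᴹ Q → Q ≈ᴹ S → P ≈ᴹ S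
  ≈ᴹ-trans (eqᴹ a b c d) (eqᴹ a′ b′ c′ d′) =
    eqᴹ (trans a a′) (trans b b′) (trans c c′) (trans d d′)

  ·-cong : ∀ {P P′ Q Q′} → P ≈ᴹ P′ → Q ≈ᴹ Q′ → (P · Q) ≈ᴹ (P′ · Q′)
  ·-cong (eqᴹ a b c d) (eqᴹ e f g h) = eqᴹ
    (+-cong (*-cong a e) (*-cong b g)) (+-cong (*-cong a f) (*-cong b h))
    (+-cong (*-cong c e) (*-cong d g)) (+-cong (*-cong c f) (*-cong d h))

  ·-identityʳ : ∀ P → (P · Id) ≈ᴹ P
  ·-identityʳ (mat a b c d) = eqᴹ (first a b) (second a b) (first c d) (second c d)
    where
    first : ∀ x y → x * 1# + y * 0# ≈ x
    first = solve 2 (λ x y → x :* :1 :+ y :* :0 := x) refl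
    second : ∀ x y → x * 0# + y * 1# ≈ y
    second x y = trans (+-comm _ _) (first y x)

  ·-assoc : ∀ P Q S → ((P · Q) · S) ≈ᴹ (P · (Q · S))
  ·-assoc (mat a b c d) (mat e f g h) (mat i j k l) =
    eqᴹ (row a b i k) (row a b j l) (row c d i k) (row c d j l)
    where
    row : ∀ x y z w → (x * e + y * g) * z + (x * f + y * h) * w
                      ≈ x * (e * z + f * w) + y * (g * z + h * w)
    row x y z w = solve 8 (λ x y z w e f g h →
      (x :* e :+ y :* g) :* z :+ (x :* f :+ y :* h) :* w
      := x :* (e :* z :+ f :* w) :+ y :* (g :* z :+ h :* w)) refl x y z w e f g h

  scalar : Carrier → Mat
  scalar e = mat e 0# 0# e

  det : Mat → Carrier
  det (mat a b c d) = a * d - b * c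

  det-· : ∀ P Q → det (P · Q) ≈ det P * det Q
  det-· (mat a b c d) (mat e f g h) = solve 8 (λ a b c d e f g h →
    (a :* e :+ b :* g) :* (c :* f :+ d :* h) :+ :- ((a :* f :+ b :* h) :* (c :* e :+ d :* g))
    := (a :* d :+ :- (b :* c)) :* (e :* h :+ :- (f :* g))) refl a b c d e f g h

  det-M : ∀ as → det (M as) ≈ 1#
  det-M []       = solve 0 (:1 :* :1 :+ :- (:0 :* :0) := :1) refl
  det-M (a ∷ as) = trans (det-· (M as) (E a)) (trans (*-cong (det-M as) det-E) (*-identityʳ 1#))
    where
    det-E : det (E a) ≈ 1#
    det-E = solve 1 (λ a → a :* :0 :+ :- (:- :1 :* :1) := :1) refl a

  M-cong : ∀ {as bs} → as ≋ bs → M as ≈ᴹ M bs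
  M-cong []            = ≈ᴹ-refl
  M-cong (a≈b ∷ as≋bs) = ·-cong (M-cong as≋bs) (eqᴹ a≈b refl refl refl)

  M-++ : ∀ as bs → M (as ++ bs) ≈ᴹ (M bs · M as)
  M-++ []       bs = ≈ᴹ-sym (·-identityʳ (M bs))
  M-++ (a ∷ as) bs = ≈ᴹ-trans (·-cong (M-++ as bs) ≈ᴹ-refl) (·-assoc (M bs) (M as) (E a))

  M-[_] : ∀ a → M [ a ] ≈ᴹ E a
  M-[ a ] = eqᴹ (first _ _) (first _ _) (second _ _) (second _ _)
    where
    first : ∀ x y → 1# * x + 0# * y ≈ x
    first = solve 2 (λ x y → :1 :* x :+ :0 :* y := x) refl
    second : ∀ x y → 0# * x + 1# * y ≈ y
    second x y = trans (+-comm _ _) (first y x)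

  M-∷ʳ : ∀ as b → M (as ++ [ b ]) ≈ᴹ (E b · M as)
  M-∷ʳ as b = ≈ᴹ-trans (M-++ as [ b ]) (·-cong M-[ b ] ≈ᴹ-refl)

  -- The anti-automorphism P ↦ D Pᵀ D with D = diag(1,−1), which fixes every E a.
  flip : Mat → Mat
  flip (mat a b c d) = mat a (- c) (- b) d

  flip-· : ∀ P Q → flip (P · Q) ≈ᴹ (flip Q · flip P)
  flip-· (mat a b c d) (mat e f g h) = eqᴹ
    (solve 4 (λ a b e g → a :* e :+ b :* g := e :* a :+ :- g :* :- b) refl a b e g)
    (solve 4 (λ c d e g → :- (c :* e :+ d :* g) := e :* :- c :+ :- g :* d) refl c d e g)
    (solve 4 (λ a b f h → :- (a :* f :+ b :* h) := :- f :* a :+ h :* :- b) refl a b f h)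
    (solve 4 (λ c d f h → c :* f :+ d :* h := :- f :* :- c :+ h :* d) refl c d f h)

  -- Reversing the list reverses the order of the factors; `flip` does the same and fixes each
  -- factor.
  M-reverse : ∀ as → M (reverse as) ≈ᴹ flip (M as)
  M-reverse []       = eqᴹ refl (sym -0#≈0#) (sym -0#≈0#) refl
  M-reverse (a ∷ as) rewrite List.unfold-reverse a as =
    ≈ᴹ-trans (M-∷ʳ (reverse as) a)
      (≈ᴹ-trans (·-cong (eqᴹ refl refl (sym (-‿involutive 1#)) refl) (M-reverse as))
        (≈ᴹ-sym (flip-· (M as) (E a))))

  -- The signed continuant: the determinant of the tridiagonal matrix with the list on its diagonal
  -- and ones beside it.
  K : List Carrier → Carrier
  K as = m11 (M as)

  K-cong : ∀ {as bs} → as ≋ bs → K as ≈ K bs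
  K-cong as≋bs = eq11 (M-cong as≋bs)

  K-reverse : ∀ as → K (reverse as) ≈ K as
  K-reverse as = eq11 (M-reverse as)

  m12-∷ : ∀ a as → m12 (M (a ∷ as)) ≈ - K as
  m12-∷ a as = solve 2 (λ x y → x :* :- :1 :+ y :* :0 := :- x) refl (K as) (m12 (M as))

  K-∷ : ∀ a as → K (a ∷ as) ≈ K as * a + m12 (M as)
  K-∷ a as = +-congˡ (*-identityʳ _)

  K-∷-∷ : ∀ a b as → K (a ∷ b ∷ as) ≈ K (b ∷ as) * a - K as
  K-∷-∷ a b as = trans (K-∷ a (b ∷ as)) (+-congˡ (m12-∷ b as))

  -- The second row of `E v` is (1, 0) and the second column of `E u` is (-1, 0), so neither end
  -- entry survives.
  m22-surround : ∀ u vs v → m22 (M (u ∷ vs ++ [ v ])) ≈ - K vs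
  m22-surround u vs v = trans (eq22 (·-cong (M-∷ʳ vs v) (≈ᴹ-refl {E u})))
    (solve 4 (λ a b c d →
      (:1 :* a :+ :0 :* c) :* :- :1 :+ (:1 :* b :+ :0 :* d) :* :0 := :- a) refl
      (K vs) (m12 (M vs)) (m21 (M vs)) (m22 (M vs)))

  -- Signs, and cyclic blocks whose continuant is a sign.

  IsSign : Carrier → Set ℓ
  IsSign e = e ≈ 1# ⊎ e ≈ - 1#

  IsSign-cong : ∀ {x y} → x ≈ y → IsSign x → IsSign y
  IsSign-cong x≈y (inj₁ p) = inj₁ (trans (sym x≈y) p)
  IsSign-cong x≈y (inj₂ p) = inj₂ (trans (sym x≈y) p)

  IsSign-neg : ∀ {x} → IsSign x → IsSign (- x)
  IsSign-neg (inj₁ p) = inj₂ (-‿cong p)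
  IsSign-neg (inj₂ p) = inj₁ (trans (-‿cong p) (-‿involutive 1#))

  IsSign-neg⁻¹ : ∀ {x} → IsSign (- x) → IsSign x
  IsSign-neg⁻¹ s = IsSign-cong (-‿involutive _) (IsSign-neg s)

  IsSign-* : ∀ {x y} → IsSign x → IsSign y → IsSign (x * y)
  IsSign-* (inj₁ p) s = IsSign-cong (sym (trans (*-congʳ p) (*-identityˡ _))) s
  IsSign-* (inj₂ p) s = IsSign-cong (sym (trans (*-congʳ p) (-1*x≈-x _))) (IsSign-neg s)

  quiddity⇒scalar : ∀ as → LambdaQuiddity as → ∃ λ e → IsSign e × M as ≈ᴹ scalar e
  quiddity⇒scalar _ (inj₁ (a , b , c , d)) = 1# , inj₁ refl , eqᴹ a b c d
  quiddity⇒scalar _ (inj₂ (a , b , c , d)) = - 1# , inj₂ refl , eqᴹ a b c d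

  K-interior : ∀ u vs v → LambdaQuiddity (u ∷ vs ++ [ v ]) → IsSign (K vs)
  K-interior u vs v q with quiddity⇒scalar (u ∷ vs ++ [ v ]) q
  ... | e , s , M≈e = IsSign-neg⁻¹ (IsSign-cong (trans (sym (eq22 M≈e)) (m22-surround u vs v)) s)

  -- Q = X⁻¹ · e · Y⁻¹ = e · (Y X)⁻¹, and (P⁻¹)₂₂ = P₁₁ when det P = 1.
  m22-middle : ∀ X Q Y {e} → det X ≈ 1# → det Y ≈ 1# → ((X · Q) · Y) ≈ᴹ scalar e →
    m22 Q ≈ e * m11 (Y · X)
  m22-middle (mat a b c d) (mat i j k l) (mat p q r s) {e} detX detY XQY≈e =
    trans (sym (trans (*-congʳ (trans (*-cong detX detY) (*-identityʳ 1#))) (*-identityˡ l)))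
    -- This is the (2,2) entry of adj(X) (X Q Y) adj(Y) = det X det Y Q.
    (trans (solve 12 (λ a b c d i j k l p q r s →
        let x11 = a :* i :+ b :* k ; x12 = a :* j :+ b :* l
            x21 = c :* i :+ d :* k ; x22 = c :* j :+ d :* l
            z11 = x11 :* p :+ x12 :* r ; z12 = x11 :* q :+ x12 :* s
            z21 = x21 :* p :+ x22 :* r ; z22 = x21 :* q :+ x22 :* s
        in (a :* d :+ :- (b :* c)) :* (p :* s :+ :- (q :* r)) :* l
           := (p :* (a :* z22 :+ :- (c :* z12))) :+ :- (q :* (a :* z21 :+ :- (c :* z11)))) refl
        a b c d i j k l p q r s)
    (trans (+-cong (*-congˡ (+-cong (*-congˡ (eq22 XQY≈e)) (-‿cong (*-congˡ (eq12 XQY≈e)))))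
        (-‿cong (*-congˡ (+-cong (*-congˡ (eq21 XQY≈e)) (-‿cong (*-congˡ (eq11 XQY≈e)))))))
      (solve 5 (λ a c p q e →
        (p :* (a :* e :+ :- (c :* :0))) :+ :- (q :* (a :* :0 :+ :- (c :* e)))
        := e :* (p :* a :+ q :* c)) refl a c p q e)))

  -- A cyclic block of continuant ±1: ms, or qs followed by ps when it runs past the end.
  data Cut : List Carrier → Set (c ⊔ ℓ) where
    straight : ∀ ps ms qs → 1 ≤ length ms → 3 ≤ length (ps ++ qs) → IsSign (K ms) →
      Cut (ps ++ ms ++ qs)
    wrapped  : ∀ ps us qs → 1 ≤ length (qs ++ ps) → 3 ≤ length us → IsSign (K (qs ++ ps)) →
      Cut (ps ++ us ++ qs)

  -- The block itself is unchanged. A straight cut becomes wrapped when the moved entry opens the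
  -- block, and a wrapped one becomes straight when the block does not reach the front.
  rot-Cut : ∀ {cs} → Cut cs → Cut (rot cs)
  rot-Cut (straight [] (m ∷ ms) qs 1≤ 3≤ s) =
    ≡.subst Cut (≡.sym (List.++-assoc ms qs [ m ])) (wrapped ms qs [ m ] 1≤ 3≤ s)
  rot-Cut (straight (p ∷ ps) ms qs 1≤ 3≤ s) =
    ≡.subst Cut (++-assoc₃ ps ms qs [ p ])
      (straight ps ms (qs ++ [ p ]) 1≤ (≡.subst (3 ≤_) (≡.sym (length-++-∷ʳ ps qs p)) 3≤) s)
  rot-Cut (wrapped [] (u ∷ us) qs 1≤ 3≤ s) rewrite List.++-identityʳ qs =
    ≡.subst Cut (≡.sym (List.++-assoc us qs [ u ]))
      (straight us qs [ u ] 1≤ (≡.subst (3 ≤_) (≡.sym (length-∷ʳ us u)) 3≤) s)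
  rot-Cut (wrapped (p ∷ ps) us qs 1≤ 3≤ s) =
    ≡.subst Cut (++-assoc₃ ps us qs [ p ])
      (wrapped ps us (qs ++ [ p ]) (≡.subst (λ xs → 1 ≤ length xs) eq 1≤) 3≤
        (≡.subst (IsSign ∘ K) eq s))
    where eq = ≡.sym (List.++-assoc qs [ p ] ps)

  rotN-Cut : ∀ k {cs} → Cut cs → Cut (rotN k cs)
  rotN-Cut zero    cut = cut
  rotN-Cut (suc k) cut = rot-Cut (rotN-Cut k cut)

  init-∷ʳ-last : ∀ b x xs → init′ (x ∷ xs) ++ [ last′ b (x ∷ xs) ] ≡ x ∷ xs
  init-∷ʳ-last b x []       = ≡.refl
  init-∷ʳ-last b x (y ∷ ys) = ≡.cong (x ∷_) (init-∷ʳ-last x y ys)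

  length-init : ∀ x xs → length (init′ (x ∷ xs)) ≡ length xs
  length-init x []       = ≡.refl
  length-init x (y ∷ ys) = ≡.cong suc (length-init y ys)

  -- The entries b₂, ..., bₘ₋₁ closing the sum are the interior of the quiddity `bs`, so
  -- `K-interior` applies to them; the entries before them are as many as those of `as`.
  ⊕-split : ∀ as bs → 3 ≤ length as → 3 ≤ length bs → LambdaQuiddity bs →
    ∃ λ us → ∃ λ ms → as ⊕ bs ≡ us ++ ms × 3 ≤ length us × 1 ≤ length ms × IsSign (K ms)
  ⊕-split (_ ∷ []) _ (s≤s ()) _ _
  ⊕-split (a ∷ a′ ∷ as) (b ∷ b′ ∷ bs) 3≤as (s≤s (s≤s 1≤bs)) q =
    a + last′ b (b′ ∷ bs) ∷ init′ (a′ ∷ as) ++ [ last′ a (a′ ∷ as) + b ] ,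
    init′ (b′ ∷ bs) ,
    ≡.cong (_ ∷_) (≡.sym (List.++-assoc (init′ (a′ ∷ as)) _ _)) ,
    ≡.subst (3 ≤_) (≡.cong suc (≡.sym (≡.trans (length-∷ʳ (init′ (a′ ∷ as)) _)
      (≡.cong suc (length-init a′ as))))) 3≤as ,
    ≡.subst (1 ≤_) (≡.sym (length-init b′ bs)) 1≤bs ,
    K-interior b (init′ (b′ ∷ bs)) (last′ b (b′ ∷ bs))
      (≡.subst (λ xs → LambdaQuiddity (b ∷ xs)) (≡.sym (init-∷ʳ-last b b′ bs)) q)

  -- The block from `⊕-split` ends the list, or opens it after reversal, which preserves `K`; the
  -- rotation then carries the cut along. The list `ds` appears because equivalence holds only up to
  -- entrywise `≈`.
  reducible⇒Cut : ∀ {cs} → Reducible cs → ∃ λ ds → cs ≋ ds × Cut ds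
  reducible⇒Cut (as , bs , 3≤as , 3≤bs , q , k , cs∼) with ⊕-split as bs 3≤as 3≤bs q
  reducible⇒Cut (as , bs , 3≤as , 3≤bs , q , k , inj₁ cs≋) | us , ms , eq , 3≤ , 1≤ , s =
    _ , cs≋ , rotN-Cut k (≡.subst Cut (≡.trans (≡.cong (us ++_) (List.++-identityʳ ms)) (≡.sym eq))
      (straight us ms [] 1≤ (≡.subst (λ xs → 3 ≤ length xs) (≡.sym (List.++-identityʳ us)) 3≤) s))
  reducible⇒Cut (as , bs , 3≤as , 3≤bs , q , k , inj₂ cs≋) | us , ms , eq , 3≤ , 1≤ , s =
    _ , cs≋ , rotN-Cut k (≡.subst Cut
      (≡.trans (≡.sym (List.reverse-++ us ms)) (≡.cong reverse (≡.sym eq)))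
      (straight [] (reverse ms) (reverse us)
        (≡.subst (1 ≤_) (≡.sym (List.length-reverse ms)) 1≤)
        (≡.subst (3 ≤_) (≡.sym (List.length-reverse us)) 3≤)
        (IsSign-cong (sym (K-reverse ms)) s)))

  -- Both sides are nonempty so that the first and last entries, which `complete` supplies without
  -- control over their values, stay outside the block.
  InteriorCut : List Carrier → Set (c ⊔ ℓ)
  InteriorCut cs = ∃ λ ps → ∃ λ ms → ∃ λ qs → cs ≋ (ps ++ ms ++ qs) ×
    1 ≤ length ps × 1 ≤ length ms × 1 ≤ length qs × 3 ≤ length (ps ++ qs) × IsSign (K ms)

  -- The block complementary to a cyclic block of continuant ±1 also has continuant ±1,
  -- so a cut through the ends of the list can be traded for one that avoids them.
  wrapped⇒InteriorCut : ∀ {cs} ps us qs → LambdaQuiddity cs → cs ≋ (ps ++ us ++ qs) →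
    1 ≤ length (qs ++ ps) → 3 ≤ length us → IsSign (K (qs ++ ps)) → InteriorCut cs
  wrapped⇒InteriorCut {cs} ps us qs q cs≋ 1≤ 3≤ s with ∃-ends us 3≤
  ... | u , vs , v , ≡.refl , 1≤vs =
    -- The new block is `us` stripped of `u` and `v`; these join the two sides and make them
    -- nonempty.
    ps ++ [ u ] , vs , v ∷ qs , ≡.subst (cs ≋_) eq cs≋ ,
    ≡.subst (1 ≤_) (≡.sym (length-∷ʳ ps u)) (s≤s z≤n) , 1≤vs , s≤s z≤n ,
    ≡.subst (3 ≤_) (≡.sym len) (s≤s (s≤s 1≤)) ,
    IsSign-neg⁻¹ (IsSign-cong K-vs (IsSign-* e-sign s))
    where
    eq : ps ++ (u ∷ vs ++ [ v ]) ++ qs ≡ (ps ++ [ u ]) ++ vs ++ v ∷ qs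
    eq = ≡.trans (≡.cong (λ xs → ps ++ u ∷ xs) (List.++-assoc vs [ v ] qs))
      (≡.sym (List.++-assoc ps [ u ] (vs ++ v ∷ qs)))

    len : length ((ps ++ [ u ]) ++ v ∷ qs) ≡ suc (suc (length (qs ++ ps)))
    len = ≡.trans (≡.cong length (List.++-assoc ps [ u ] (v ∷ qs)))
      (≡.trans (List.length-++-comm ps (u ∷ v ∷ qs)) ≡.refl)

    scalar-e = quiddity⇒scalar cs q
    e      = proj₁ scalar-e
    e-sign = proj₁ (proj₂ scalar-e)
    M≈e    = proj₂ (proj₂ scalar-e)

    M-product : ((M qs · M us) · M ps) ≈ᴹ scalar e
    M-product = ≈ᴹ-trans (≈ᴹ-sym (≈ᴹ-trans (M-cong cs≋) (≈ᴹ-trans (M-++ ps (us ++ qs))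
      (·-cong (M-++ us qs) ≈ᴹ-refl)))) M≈e

    K-vs : e * K (qs ++ ps) ≈ - K vs
    K-vs = trans (*-congˡ (eq11 (M-++ qs ps)))
      (trans (sym (m22-middle (M qs) (M us) (M ps) (det-M qs) (det-M ps) M-product))
        (m22-surround u vs v))

  -- A straight block touching an end of the list is read as a wrapped one with an empty piece at
  -- the other end.
  Cut⇒InteriorCut : ∀ {cs ds} → LambdaQuiddity cs → cs ≋ ds → Cut ds → InteriorCut cs
  Cut⇒InteriorCut q cs≋ (wrapped ps us qs 1≤ 3≤ s) = wrapped⇒InteriorCut ps us qs q cs≋ 1≤ 3≤ s
  Cut⇒InteriorCut q cs≋ (straight [] ms qs 1≤ 3≤ s) =
    wrapped⇒InteriorCut ms qs [] q
      (≡.subst (_ ≋_) (≡.cong (ms ++_) (≡.sym (List.++-identityʳ qs))) cs≋)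
      1≤ 3≤ s
  Cut⇒InteriorCut q cs≋ (straight (p ∷ ps) ms [] 1≤ 3≤ s)
    rewrite List.++-identityʳ ms | List.++-identityʳ ps =
    wrapped⇒InteriorCut [] (p ∷ ps) ms q cs≋
      (≡.subst (λ xs → 1 ≤ length xs) (≡.sym (List.++-identityʳ ms)) 1≤)
      3≤ (≡.subst (IsSign ∘ K) (≡.sym (List.++-identityʳ ms)) s)
  Cut⇒InteriorCut q cs≋ (straight (p ∷ ps) ms (q₀ ∷ qs) 1≤ 3≤ s) =
    p ∷ ps , ms , q₀ ∷ qs , cs≋ , s≤s z≤n , 1≤ , s≤s z≤n , 3≤ , s

  irreducible : ∀ {cs} → 3 ≤ length cs → LambdaQuiddity cs → ¬ InteriorCut cs → Irreducible cs
  irreducible 3≤ q noCut = 3≤ , q , λ red →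
    let ds , cs≋ , cut = reducible⇒Cut red in noCut (Cut⇒InteriorCut q cs≋ cut)

  -- With these end entries the off-diagonal entries of the product are multiples of `K ds + 1#`,
  -- the (1,1) entry is the determinant up to such a multiple, and the (2,2) entry is -`K ds`. The
  -- product is thus the identity.
  complete : ∀ ds → K ds ≈ - 1# →
    LambdaQuiddity (m12 (M ds) ∷ ds ++ [ - m21 (M ds) ])
  complete ds K≈-1 = inj₁
    ( trans (eq11 M≈)
        (trans (solve 4 (λ a b c d →
            (:- c :* a :+ :- :1 :* c) :* b :+ (:- c :* b :+ :- :1 :* d) :* :1
            := (a :* d :+ :- (b :* c)) :+ (a :+ :1) :* :- (c :* b :+ d)) refl p q r s)
          (trans (+-cong (det-M ds) (trans (*-congʳ p+1≈0) (zeroˡ _))) (+-identityʳ _)))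
    , trans (eq12 M≈)
        (trans (solve 4 (λ a b c d →
            (:- c :* a :+ :- :1 :* c) :* :- :1 :+ (:- c :* b :+ :- :1 :* d) :* :0
            := (a :+ :1) :* c) refl p q r s)
          (trans (*-congʳ p+1≈0) (zeroˡ _)))
    , trans (eq21 M≈)
        (trans (solve 4 (λ a b c d →
            (:1 :* a :+ :0 :* c) :* b :+ (:1 :* b :+ :0 :* d) :* :1 := (a :+ :1) :* b) refl p q r s)
          (trans (*-congʳ p+1≈0) (zeroˡ _)))
    , trans (eq22 M≈)
        (trans (solve 4 (λ a b c d →
            (:1 :* a :+ :0 :* c) :* :- :1 :+ (:1 :* b :+ :0 :* d) :* :0 := :- a) refl p q r s)
          (trans (-‿cong K≈-1) (-‿involutive 1#)))
    )
    where
    p = m11 (M ds)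
    q = m12 (M ds)
    r = m21 (M ds)
    s = m22 (M ds)

    M≈ : M (q ∷ ds ++ [ - r ]) ≈ᴹ ((E (- r) · M ds) · E q)
    M≈ = ·-cong (M-∷ʳ ds (- r)) ≈ᴹ-refl

    p+1≈0 : p + 1# ≈ 0#
    p+1≈0 = trans (+-congʳ K≈-1) (-‿inverseˡ 1#)

  -- Euler's identity K(y,as) K(as,b,bs) - K(as) K(y,as,b,bs) = K(bs), specialised to a full
  -- continuant equal to -1.
  euler : ∀ y as b bs → K (y ∷ as ++ b ∷ bs) ≈ - 1# →
    K (y ∷ as) * K (as ++ b ∷ bs) ≈ K bs - K as
  euler y as b bs K≈-1 = begin
    K (y ∷ as) * K (as ++ b ∷ bs)
      ≈⟨ *-cong (K-∷ y as) (eq11 Q·P) ⟩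
    (p * y + q) * (i * p + j * r)
      -- The product is `K as` times the full continuant, plus a remainder with the factor
      -- det(`M as`) = 1.
      ≈⟨ solve 7 (λ y p q r s i j →
           (p :* y :+ q) :* (i :* p :+ j :* r)
           := p :* ((i :* p :+ j :* r) :* y :+ (i :* q :+ j :* s))
              :+ (:- j :* (p :* s :+ :- (q :* r)))) refl y p q r s i j ⟩
    p * ((i * p + j * r) * y + (i * q + j * s)) + - j * (p * s - q * r)
      ≈⟨ +-cong (*-congˡ (+-cong (*-congʳ (eq11 Q·P)) (eq12 Q·P))) refl ⟨
    p * (K (as ++ b ∷ bs) * y + m12 (M (as ++ b ∷ bs))) + - j * (p * s - q * r)
      ≈⟨ +-cong (*-congˡ (trans (sym (K-∷ y (as ++ b ∷ bs))) K≈-1))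
           (*-cong (-‿cong (m12-∷ b bs)) (det-M as)) ⟩
    p * - 1# + - (- K bs) * 1#
      ≈⟨ solve 2 (λ p k → p :* :- :1 :+ :- (:- k) :* :1 := k :+ :- p) refl p (K bs) ⟩
    K bs - p ∎
    where
    open SetoidReasoning setoid
    p = m11 (M as)
    q = m12 (M as)
    r = m21 (M as)
    s = m22 (M as)
    i = m11 (M (b ∷ bs))
    j = m12 (M (b ∷ bs))
    Q·P = M-++ as (b ∷ bs)

-- Blocks of lists that are constant up to the last entry.

-- As `qs` is nonempty it absorbs the final `z`, so `ps` faces copies of `t` only.
Pointwise-replicate-++ : ∀ {a r} {A : Set a} {_~_ : A → A → Set r} {t z} n ps {qs} →
  Pointwise _~_ (replicate n t ++ [ z ]) (ps ++ qs) → 1 ≤ length qs →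
  Pointwise _~_ (replicate (length ps) t) ps
Pointwise-replicate-++ n       []       _        _  = []
Pointwise-replicate-++ zero    (p ∷ []) (_ ∷ []) ()
Pointwise-replicate-++ (suc n) (p ∷ ps) (t~p ∷ t~) 1≤ = t~p ∷ Pointwise-replicate-++ n ps t~ 1≤

length-replicate-∷ʳ : ∀ {a} {A : Set a} n {t z : A} → length (replicate n t ++ [ z ]) ≡ suc n
length-replicate-∷ʳ n {t} {z} =
  ≡.trans (length-∷ʳ (replicate n t) z) (≡.cong suc (List.length-replicate n))

replicate-+ : ∀ {a} {A : Set a} m n {t : A} → replicate (m ℕ.+ n) t ≡ replicate m t ++ replicate n t
replicate-+ zero    n = ≡.refl
replicate-+ (suc m) n = ≡.cong (_ ∷_) (replicate-+ m n)

-- Long irreducible quiddities over the power series ring.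

module Construction {c ℓ : Level} (A : CommutativeRing c ℓ)
  (0≉1 : ¬ (CommutativeRing._≈_ A (CommutativeRing.0# A) (CommutativeRing.1# A))) where
  open CommutativeRing A hiding (zero)
  open Algebra.Properties.Ring ring using (-‿involutive; -0#≈0#)
  open PowerSeriesTheory A
  private module S where
    open CommutativeRing powerSeries public
    open Algebra.Properties.Ring (CommutativeRing.ring powerSeries) public using (-1*x≈-x)
  open Quiddity S.rawRing
  open QuiddityTheory powerSeries
  open Mat

  -- The rescaled Chebyshev polynomial of the second kind, U_j(X/2), seen as a power series.
  K^ : ℕ → S.Carrier
  K^ j = K (replicate j X)

  K^-1 : ∀ k → K^ 1 k ≈ X k
  K^-1 k = trans (K-∷ X [] k) (trans (+-congʳ (S.*-identityˡ X k)) (+-identityʳ _))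

  K^-suc-suc : ∀ j k → K^ (suc (suc j)) (suc k) ≈ K^ (suc j) k - K^ j (suc k)
  K^-suc-suc j k = trans (K-∷-∷ X X (replicate j X) (suc k))
    (+-congʳ (trans (S.*-comm (K^ (suc j)) X (suc k)) (X-*-suc (K^ (suc j)) k)))

  x-0≈x : ∀ {x y} → y ≈ 0# → x - y ≈ x
  x-0≈x y≈0 = trans (+-congˡ (trans (-‿cong y≈0) -0#≈0#)) (+-identityʳ _)

  K^-degree : ∀ j k → j < k → K^ j k ≈ 0#
  K^-degree zero          (suc k)       _               = refl
  K^-degree (suc zero)    (suc (suc k)) _               = K^-1 (suc (suc k))
  K^-degree (suc zero)    (suc zero)    (s≤s ())
  K^-degree (suc (suc j)) (suc k)       (s≤s 1+j<k) = trans (K^-suc-suc j k)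
    (trans (x-0≈x (K^-degree j (suc k) (ℕ.m≤n⇒m≤1+n (ℕ.<-trans (ℕ.n<1+n j) 1+j<k))))
      (K^-degree (suc j) k 1+j<k))

  K^-leading : ∀ j → K^ j j ≈ 1#
  K^-leading zero          = refl
  K^-leading (suc zero)    = K^-1 1
  K^-leading (suc (suc j)) = trans (K^-suc-suc j (suc j))
    (trans (x-0≈x (K^-degree j (suc (suc j)) (ℕ.m≤n⇒m≤1+n (ℕ.n<1+n j)))) (K^-leading (suc j)))

  K^-constant-suc-suc : ∀ j → K^ (suc (suc j)) 0 ≈ - K^ j 0
  K^-constant-suc-suc j = trans (K-∷-∷ X X (replicate j X) 0)
    (trans (+-congʳ (zeroʳ _)) (+-identityˡ _))

  -- At X = 0 the recurrence changes the sign every two steps, so the constant terms run through 1,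
  -- 0, -1, 0 with period four.
  K^-constant : ∀ m → K^ (m ℕ.* 4) 0 ≈ 1#
  K^-constant zero    = refl
  K^-constant (suc m) = trans (K^-constant-suc-suc (2 ℕ.+ m ℕ.* 4))
    (trans (-‿cong (K^-constant-suc-suc (m ℕ.* 4))) (trans (-‿involutive _) (K^-constant m)))

  sign-higher-coefficient : ∀ {δ} → IsSign δ → ∀ k → δ (suc k) ≈ 0#
  sign-higher-coefficient (inj₁ δ≈1)  k = δ≈1 (suc k)
  sign-higher-coefficient (inj₂ δ≈-1) k = trans (δ≈-1 (suc k)) -0#≈0#

  -- The leading coefficient 1 sits in positive degree, where a sign has coefficient 0.
  K^-not-sign : ∀ j → ¬ IsSign (K^ (suc j))
  K^-not-sign j s =
    0≉1 (trans (sym (sign-higher-coefficient s j)) (K^-leading (suc j)))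

  sign≉0 : ∀ {e} → e ≈ 1# ⊎ e ≈ - 1# → ¬ (e ≈ 0#)
  sign≉0 (inj₁ e≈1)  e≈0 = 0≉1 (trans (sym e≈0) e≈1)
  sign≉0 (inj₂ e≈-1) e≈0 = 0≉1 (trans (trans (sym -0#≈0#) (-‿cong (trans (sym e≈0) e≈-1)))
    (-‿involutive 1#))

  module _ (n : ℕ) (y : S.Carrier) (K≈-1 : K (y ∷ replicate n X) S.≈ S.- S.1#) where

    -- By Euler's identity ±K(Xⁿ) = K(Xⁱ) − K(Xʲ) with i, j < n, but K(Xⁿ) is monic of degree n.
    K-y∷X-not-sign : ∀ j → j < n → ¬ IsSign (K (y ∷ replicate j X))
    K-y∷X-not-sign j j<n s with ℕ.m≤n⇒∃[o]m+o≡n j<n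
    ... | i , ≡.refl = sign≉0 (leading s) (trans (identity n) difference≈0)
      where
      -- The `X` between the two powers plays the entry `b` of `euler`.
      split : replicate (suc j ℕ.+ i) X ≡ replicate j X ++ X ∷ replicate i X
      split = ≡.trans (≡.cong (λ m → replicate m X) (≡.sym (ℕ.+-suc j i))) (replicate-+ j (suc i))

      identity : (K (y ∷ replicate j X) S.* K^ n) S.≈ (K^ i S.- K^ j)
      identity = ≡.subst (λ xs → (K (y ∷ replicate j X) S.* K xs) S.≈ (K^ i S.- K^ j)) (≡.sym split)
        (euler y (replicate j X) X (replicate i X)
          (≡.subst (λ xs → K (y ∷ xs) S.≈ (S.- S.1#)) split K≈-1))

      difference≈0 : (K^ i S.- K^ j) n ≈ 0#
      difference≈0 = trans (x-0≈x (K^-degree j n j<n)) (K^-degree i n (s≤s (ℕ.m≤n+m i j)))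

      leading : IsSign (K (y ∷ replicate j X)) →
        (K (y ∷ replicate j X) S.* K^ n) n ≈ 1# ⊎ (K (y ∷ replicate j X) S.* K^ n) n ≈ - 1#
      leading (inj₁ δ≈1)  = inj₁ (trans (S.*-congʳ {K^ n} δ≈1 n)
        (trans (S.*-identityˡ (K^ n) n) (K^-leading n)))
      leading (inj₂ δ≈-1) = inj₂ (trans (S.*-congʳ {K^ n} δ≈-1 n)
        (trans (S.-1*x≈-x (K^ n) n) (-‿cong (K^-leading n))))

    x z : S.Carrier
    x = m12 (M (y ∷ replicate n X))
    z = S.- m21 (M (y ∷ replicate n X))

    quiddity : List S.Carrier
    quiddity = x ∷ y ∷ replicate n X ++ [ z ]

    quiddity-length : length quiddity ≡ 3 ℕ.+ n
    quiddity-length = ≡.cong (suc ∘ suc) (length-replicate-∷ʳ n)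

    -- An interior block never contains `x` or `z`: either it starts at `y`, when a single entry
    -- precedes it, or it consists of copies of `X` only.
    quiddity-no-InteriorCut : ¬ InteriorCut quiddity
    quiddity-no-InteriorCut (p ∷ [] , m ∷ ms , qs , _ ∷ y≈m ∷ tail≋ , _ , _ , 1≤qs , s≤s 2≤qs , s) =
      K-y∷X-not-sign (length ms) ms<n
        (IsSign-cong (S.sym (K-cong {y ∷ replicate (length ms) X}
          (y≈m ∷ Pointwise-replicate-++ n ms tail≋ 1≤qs))) s)
      where
      ms<n : length ms < n
      -- All of `y ∷ replicate n X` does have continuant -1. It is excluded because a lone entry
      -- before the block forces at least two after it.
      ms<n = ℕ.s≤s⁻¹ (ℕ.≤-trans (ℕ.≤-reflexive (ℕ.+-comm 2 (length ms)))
        (ℕ.≤-trans (ℕ.+-monoʳ-≤ (length ms) 2≤qs) (ℕ.≤-reflexive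
          (≡.trans (≡.sym (List.length-++ ms))
            (≡.trans (≡.sym (Pointwise.Pointwise-length tail≋)) (length-replicate-∷ʳ n))))))
    quiddity-no-InteriorCut (p ∷ p′ ∷ ps , m ∷ ms , qs , _ ∷ _ ∷ tail≋ , _ , _ , 1≤qs , _ , s) =
      K^-not-sign (length ms) (IsSign-cong (S.sym (K-cong (drop ps n tail≋))) s)
      where
      drop : ∀ ps n → (replicate n X ++ [ z ]) ≋ (ps ++ (m ∷ ms) ++ qs) →
        replicate (length (m ∷ ms)) X ≋ (m ∷ ms)
      drop []       n       eq        = Pointwise-replicate-++ n (m ∷ ms) eq 1≤qs
      drop (p ∷ ps) (suc n) (_ ∷ eq)  = drop ps n eq
      drop (p ∷ []) zero (_ ∷ ())
      drop (p ∷ _ ∷ _) zero (_ ∷ ())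

    quiddity-irreducible : Irreducible quiddity
    quiddity-irreducible = irreducible
      (≡.subst (3 ≤_) (≡.sym quiddity-length) (ℕ.m≤m+n 3 n))
      (complete (y ∷ replicate n X) K≈-1) quiddity-no-InteriorCut

  -- The continuant is affine in its first entry with slope `K^ n`, a unit by its constant term, so
  -- the equation can be solved for `y`.
  ∃-first-entry : ∀ n → K^ n 0 ≈ 1# → ∃ λ y → K (y ∷ replicate n X) S.≈ S.- S.1#
  ∃-first-entry n K₀≈1 = y , λ k → trans (K-∷ y xs k) (K-y k)
    where
    xs = replicate n X
    b = m12 (M xs)
    inv = invertible (K^ n) K₀≈1
    g = proj₁ inv
    d = S.- S.1# S.- b
    y = g S.* d
    K-y : (K^ n S.* y S.+ b) S.≈ S.- S.1#
    K-y = begin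
      K^ n S.* (g S.* d) S.+ b   ≈⟨ S.+-congʳ (S.*-assoc (K^ n) g d) ⟨
      K^ n S.* g S.* d S.+ b     ≈⟨ S.+-congʳ (S.*-congʳ {d} (proj₂ inv)) ⟩
      S.1# S.* d S.+ b           ≈⟨ S.+-congʳ (S.*-identityˡ d) ⟩
      d S.+ b                      ≈⟨ S.+-assoc _ _ _ ⟩
      S.- S.1# S.+ (S.- b S.+ b)                ≈⟨ S.+-congˡ (S.-‿inverseˡ b) ⟩
      S.- S.1# S.+ S.0#                         ≈⟨ S.+-identityʳ _ ⟩
      S.- S.1#                                  ∎
      where open SetoidReasoning S.setoid

theorem3p13 : {c ℓ : Level} (A : CommutativeRing c ℓ) →
    ¬ (CommutativeRing._≈_ A (CommutativeRing.0# A) (CommutativeRing.1# A)) →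
    Quiddity.EllInfinite (PowerSeries.PowerSeriesRing A)
theorem3p13 A 0≉1 N =
  -- A multiple of four, so that `K^ n` has constant term 1; the quiddity then has length n + 3, at
  -- least `N`.
  let n        = N ℕ.* 4
      y , K≈-1 = ∃-first-entry n (K^-constant N)
  in quiddity n y K≈-1
   , ℕ.≤-trans (ℕ.≤-trans (ℕ.m≤m*n N 4) (ℕ.m≤n+m n 3))
       (ℕ.≤-reflexive (≡.sym (quiddity-length n y K≈-1)))
   , quiddity-irreducible n y K≈-1
  where open Construction A 0≉1
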